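{- Let $G$ be a graph that is $P_5$-free and $C_5$-free. Then $G$ is $2$-divisible; that is, for every induced subgraph $H$ of $G$ having at least one edge, $V(H)$ can be partitioned into two sets $A,B$ such that $\omega(A)<\omega(H)$ and $\omega(B)<\omega(H)$.
   Context: All graphs are finite and simple. $P_5$ is the path on $5$ vertices and $C_5$ is the cycle on $5$ vertices. For a graph $F$, a graph $G$ is $F$-free if no induced subgraph of $G$ is isomorphic to $F$. $\omega(H)$ denotes the clique number of $H$ (the maximum size of a set of pairwise adjacent vertices, with value $0$ for the graph with no vertices), and for a set $X$ of vertices, $\omega(X)$ means the clique number of the subgraph induced by $X$. Parts of a partition are allowed to be empty. -}

module Defs where

open import Data.Fin using (Fin; toℕ)
open import Data.Fin.Properties using (all?) renaming (_≟_ to _≟ᶠ_)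
open import Data.Fin.Subset using (Subset; _∈_; _⊆_; _∪_; _∩_; ⊥; ∣_∣)
open import Data.Fin.Subset.Properties
  using (anySubset?; _∈?_; _⊆?_; ∣p∣≤n; ∉⊥; ∣⊥∣≡0; ⊥⊆)
open import Data.Nat using (ℕ; zero; suc; _≤_; _<_; s≤s⁻¹; _%_)
open import Data.Nat.Properties using (_≟_; 1+n≢n; m≤n⇒m<n∨m≡n)
open import Data.Product using (_×_; _,_; ∃-syntax)
open import Data.Sum using (_⊎_; inj₁; inj₂; swap)
open import Function using (_⇔_; Injective)
open import Level using (0ℓ)
open import Relation.Binary using (Rel; Symmetric; Irreflexive; Decidable)
open import Relation.Binary.PropositionalEquality using (_≡_; _≢_; refl)
open import Relation.Nullary using (¬_; yes; no; contradiction)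
open import Relation.Nullary.Decidable using (_×-dec_; _⊎-dec_; _→-dec_; ¬?; from-yes)
import Relation.Unary as U

record Graph (n : ℕ) : Set₁ where
  field
    Adj        : Rel (Fin n) 0ℓ
    adj?       : Decidable Adj
    adj-sym    : Symmetric Adj
    adj-irrefl : Irreflexive _≡_ Adj

open Graph public

P₅ : Graph 5
P₅ = record
  { Adj        = λ i j → suc (toℕ i) ≡ toℕ j ⊎ suc (toℕ j) ≡ toℕ i
  ; adj?       = λ i j → (suc (toℕ i) ≟ toℕ j) ⊎-dec (suc (toℕ j) ≟ toℕ i)
  ; adj-sym    = swap
  ; adj-irrefl = λ { refl (inj₁ e) → 1+n≢n e ; refl (inj₂ e) → 1+n≢n e }
  }

C₅ : Graph 5
C₅ = record
  { Adj        = λ i j → suc (toℕ i) % 5 ≡ toℕ j ⊎ suc (toℕ j) % 5 ≡ toℕ i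
  ; adj?       = λ i j → (suc (toℕ i) % 5 ≟ toℕ j) ⊎-dec (suc (toℕ j) % 5 ≟ toℕ i)
  ; adj-sym    = swap
  ; adj-irrefl = λ { {i} refl (inj₁ e) → no-fixpoint i e ; {i} refl (inj₂ e) → no-fixpoint i e }
  }
  where
  no-fixpoint : (i : Fin 5) → suc (toℕ i) % 5 ≢ toℕ i
  no-fixpoint = from-yes (all? λ (i : Fin 5) → ¬? (suc (toℕ i) % 5 ≟ toℕ i))

-- An induced subgraph of G is determined by its vertex set, so G[S] is
-- represented by the pair of G and S : Subset n.  An isomorphism from F to
-- G[S] is then a map into the vertices of G whose image is exactly S.

record _≅_[_] {m n : ℕ} (F : Graph m) (G : Graph n) (S : Subset n) : Set where
  field
    to        : Fin m → Fin n
    injective : Injective _≡_ _≡_ to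
    image     : ∀ v → v ∈ S ⇔ (∃[ u ] to u ≡ v)
    adjacency : ∀ u v → Adj F u v ⇔ Adj G (to u) (to v)

infix 4 _-Free_

_-Free_ : ∀ {m n} → Graph m → Graph n → Set
F -Free G = ¬ (∃[ S ] F ≅ G [ S ])

module _ {n : ℕ} (G : Graph n) where

  IsClique : Subset n → Set
  IsClique K = ∀ u v → u ∈ K → v ∈ K → u ≢ v → Adj G u v

  isClique? : U.Decidable IsClique
  isClique? K = all? λ u → all? λ v →
    (u ∈? K) →-dec (v ∈? K) →-dec ¬? (u ≟ᶠ v) →-dec adj? G u v

  HasClique : Subset n → ℕ → Set
  HasClique X k = ∃[ K ] K ⊆ X × IsClique K × ∣ K ∣ ≡ k

  hasClique? : ∀ X → U.Decidable (HasClique X)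
  hasClique? X k = anySubset? λ K → (K ⊆? X) ×-dec isClique? K ×-dec (∣ K ∣ ≟ k)

greatest : {P : ℕ → Set} → U.Decidable P → ℕ → ℕ
greatest P? zero    = 0
greatest P? (suc b) with P? (suc b)
... | yes _ = suc b
... | no  _ = greatest P? b

-- The clique number of G[X].  The search bound n loses nothing: see
-- ω-attained and ω-maximal.

ω : ∀ {n} → Graph n → Subset n → ℕ
ω {n} G X = greatest (hasClique? G X) n

module _ {P : ℕ → Set} (P? : U.Decidable P) where

  greatest-satisfies : P 0 → ∀ b → P (greatest P? b)
  greatest-satisfies p₀ zero    = p₀
  greatest-satisfies p₀ (suc b) with P? (suc b)
  ... | yes p = p
  ... | no  _ = greatest-satisfies p₀ b

  greatest-upper : ∀ b {k} → k ≤ b → P k → k ≤ greatest P? b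
  greatest-upper zero    k≤b _ = k≤b
  greatest-upper (suc b) k≤b p with P? (suc b)
  ... | yes _ = k≤b
  ... | no ¬p with m≤n⇒m<n∨m≡n k≤b
  ...   | inj₁ k<1+b = greatest-upper b (s≤s⁻¹ k<1+b) p
  ...   | inj₂ refl  = contradiction p ¬p

module _ {n : ℕ} (G : Graph n) (X : Subset n) where

  ω-attained : HasClique G X (ω G X)
  ω-attained = greatest-satisfies (hasClique? G X)
    (⊥ , ⊥⊆ , (λ _ _ u∈⊥ → contradiction u∈⊥ ∉⊥) , ∣⊥∣≡0 n) n

  ω-maximal : ∀ K → K ⊆ X → IsClique G K → ∣ K ∣ ≤ ω G X
  ω-maximal K K⊆X K-clique =
    greatest-upper (hasClique? G X) n (∣p∣≤n K) (K , K⊆X , K-clique , refl)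

HasEdge : ∀ {n} → Graph n → Subset n → Set
HasEdge G X = ∃[ u ] ∃[ v ] u ∈ X × v ∈ X × Adj G u v

IsPartition : ∀ {n} → Subset n → Subset n → Subset n → Set
IsPartition X A B = A ∪ B ≡ X × A ∩ B ≡ ⊥

TwoDivisible : ∀ {n} → Graph n → Set
TwoDivisible G = ∀ H → HasEdge G H →
  ∃[ A ] ∃[ B ] IsPartition H A B × ω G A < ω G H × ω G B < ω G H

{-# OPTIONS --safe #-}

-- If a vertex c is adjacent to all others, split off {c}.  Otherwise choose
-- inside H a connected set C, maximal subject to some vertex of H lying
-- outside C and having no neighbour in C.  Let S be the set of vertices of H
-- attached to C and W the rest of H; by maximality W is complete to S.  If S
-- is empty, C and H ∖ C are split separately.  Otherwise pick x ∈ S with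
-- N(x) ∩ C largest and split H into N(x) and its complement.  A clique of H
-- dominated by a vertex is not maximum, which settles N(x).  Let K be a clique
-- in the complement and v ∈ W.
-- * Nonadjacent x, y ∈ S have comparable neighbourhoods in C (otherwise a path
--   x v y closes up to P₅ or C₅ through C), so if K meets S then K ⊆ S, and v
--   dominates K.
-- * Otherwise K ⊆ C ∖ N(x).  A vertex c ∈ C ∩ N(x) adjacent to d ∈ C ∖ N(x) is
--   adjacent to every neighbour d′ ∈ C ∖ N(x) of d (otherwise v x c d d′ is P₅),
--   and C is connected, so some c ∈ C ∩ N(x) dominates K.
module Submission where

open import Defs
open import Data.Bool using (true)
import Data.Bool.Properties as Bool
open import Data.Fin using (Fin; zero; suc) renaming (_<_ to _<ᶠ_)
open import Data.Fin.Properties using (all?; any?; <-cmp) renaming (_≟_ to _≟ᶠ_)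
open import Data.Fin.Subset using (Subset; _∈_; _∉_; _⊆_; _⊂_; _⊃_; _∪_; _∩_; ∁; ⁅_⁆; ∣_∣; Nonempty)
open import Data.Fin.Subset.Induction using (Acc; acc; ⊂-wellFounded; ⊃-wellFounded)
open import Data.Fin.Subset.Properties
open import Data.Nat using (ℕ; zero; suc; _≤_; _<_; z≤n; s≤s; s≤s⁻¹)
open import Data.Nat.Properties using (≤-refl; ≤-reflexive; ≤-trans; <-≤-trans; <⇒≤; <-irrefl; _≤?_)
open import Data.Product using (_×_; _,_; ∃-syntax; proj₁; proj₂)
open import Data.Sum using (_⊎_; inj₁; inj₂)
open import Data.Vec using (lookup; tabulate; []; _∷_)
open import Data.Vec.Properties using (lookup∘tabulate; lookup⇒[]=; []=⇒lookup)
open import Function using (_⇔_; mk⇔; _∘_; Equivalence)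
open import Relation.Binary using (tri<; tri≈; tri>)
open import Relation.Binary.PropositionalEquality using (_≡_; refl; sym; trans; cong; subst)
open import Relation.Nullary using (¬_; Dec; yes; no; does; contradiction; Reflects; ofʸ; ofⁿ)
open import Relation.Nullary.Decidable using (_×-dec_; _⊎-dec_; _→-dec_; ¬?; from-yes; dec-true; does-⇔; decidable-stable)
open import Relation.Unary using (Pred; Decidable)
open import Level using (0ℓ)

open Equivalence using (to; from)

-- Finite sets of vertices.

module _ {n} {P : Pred (Fin n) 0ℓ} (P? : Decidable P) where

  comprehension : Subset n
  comprehension = tabulate (does ∘ P?)

  ∈-comprehension : ∀ {v} → v ∈ comprehension ⇔ P v
  ∈-comprehension {v} = mk⇔
    (λ v∈ → true⇒ (P? v) (trans (sym (lookup∘tabulate (does ∘ P?) v)) ([]=⇒lookup v∈)))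
    (λ p → lookup⇒[]= v _ (trans (lookup∘tabulate (does ∘ P?) v) (dec-true (P? v) p)))
    where
    true⇒ : ∀ {A : Set} (a? : Dec A) → does a? ≡ true → A
    true⇒ (yes a) _ = a

∪-lub : ∀ {n} {p q r : Subset n} → p ⊆ r → q ⊆ r → p ∪ q ⊆ r
∪-lub {p = p} {q} p⊆r q⊆r x∈ with x∈p∪q⁻ p q x∈
... | inj₁ x∈p = p⊆r x∈p
... | inj₂ x∈q = q⊆r x∈q

⁅x⁆⊆ : ∀ {n} {x : Fin n} {p} → x ∈ p → ⁅ x ⁆ ⊆ p
⁅x⁆⊆ {x = x} {p} x∈p y∈ = subst (_∈ p) (sym (x∈⁅y⁆⇒x≡y x y∈)) x∈p

x∈⁅x⁆∪p : ∀ {n} (x : Fin n) (p : Subset n) → x ∈ ⁅ x ⁆ ∪ p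
x∈⁅x⁆∪p x p = x∈p∪q⁺ (inj₁ (x∈⁅x⁆ x))

p⊂⁅x⁆∪p : ∀ {n} {x : Fin n} {p : Subset n} → x ∉ p → p ⊂ ⁅ x ⁆ ∪ p
p⊂⁅x⁆∪p {x = x} {p} x∉p = q⊆p∪q ⁅ x ⁆ p , x , x∈⁅x⁆∪p x p , x∉p

-- Induced copies of a small graph.

-- Two vertices of F with the same neighbours are equal, so that a map which
-- preserves and reflects adjacency is automatically injective.
TwinFree : ∀ {m} → Graph m → Set
TwinFree F = ∀ u v → (∀ w → does (adj? F u w) ≡ does (adj? F v w)) → u ≡ v

twinFree? : ∀ {m} (F : Graph m) → Dec (TwinFree F)
twinFree? F = all? λ u → all? λ v →
  all? (λ w → does (adj? F u w) Bool.≟ does (adj? F v w)) →-dec (u ≟ᶠ v)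

reflects⇒⇔ : ∀ {A B : Set} (a? : Dec A) → Reflects B (does a?) → A ⇔ B
reflects⇒⇔ (yes a) (ofʸ b)  = mk⇔ (λ _ → b) (λ _ → a)
reflects⇒⇔ (no ¬a) (ofⁿ ¬b) = mk⇔ (λ a → contradiction a ¬a) (λ b → contradiction b ¬b)

-- Symmetry and irreflexivity reduce the check to pairs `u < v`. Since `does (adj? F u v)` computes
-- for a concrete `F`, each pair is then settled by `ofʸ` or `ofⁿ`.
module _ {m n} {F : Graph m} (G : Graph n) (f : Fin m → Fin n) (twinFree : TwinFree F)
  (adj-reflects : ∀ u v → u <ᶠ v → Reflects (Adj G (f u) (f v)) (does (adj? F u v))) where

  private
    adj⇔ : ∀ u v → Adj F u v ⇔ Adj G (f u) (f v)
    adj⇔ u v with <-cmp u v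
    ... | tri< u<v _ _ = reflects⇒⇔ (adj? F u v) (adj-reflects u v u<v)
    ... | tri≈ _ u≡v _ = mk⇔ (λ e → contradiction e (adj-irrefl F u≡v))
                             (λ e → contradiction e (adj-irrefl G (cong f u≡v)))
    ... | tri> _ _ v<u = mk⇔ (adj-sym G ∘ to v⇔u ∘ adj-sym F) (adj-sym F ∘ from v⇔u ∘ adj-sym G)
      where v⇔u = reflects⇒⇔ (adj? F v u) (adj-reflects v u v<u)

    neighbour : ∀ {u v} → f u ≡ f v → ∀ {w} → Adj F u w → Adj F v w
    neighbour {u} {v} fu≡fv {w} e =
      from (adj⇔ v w) (subst (λ z → Adj G z (f w)) fu≡fv (to (adj⇔ u w) e))

  embedding⇒¬free : ¬ (F -Free G)
  embedding⇒¬free free = free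
    ( comprehension image?
    , record
      { to        = f
      ; injective = λ {u} {v} fu≡fv → twinFree u v λ w →
          does-⇔ (mk⇔ (neighbour fu≡fv) (neighbour (sym fu≡fv))) (adj? F u w) (adj? F v w)
      ; image     = λ v → ∈-comprehension image?
      ; adjacency = adj⇔
      } )
    where
    image? : Decidable (λ v → ∃[ u ] f u ≡ v)
    image? v = any? λ u → f u ≟ᶠ v

pattern 0F = zero
pattern 1F = suc zero
pattern 2F = suc 1F
pattern 3F = suc 2F
pattern 4F = suc 3F

-- Connected vertex sets.

module _ {n} (G : Graph n) where

  infix 4 _~_ _≁_

  _~_ _≁_ : Fin n → Fin n → Set
  _~_ = Adj G
  u ≁ v = ¬ (u ~ v)

  -- Connectedness without walks: a predicate that spreads along the edges
  -- inside C spreads from any vertex of C to all of C.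
  Connected : Subset n → Set₁
  Connected C = (P : Pred (Fin n) 0ℓ) →
    (∀ {u w} → u ∈ C → w ∈ C → u ~ w → P u → P w) →
    ∀ {a b} → a ∈ C → b ∈ C → P a → P b

  ⁅⁆-connected : ∀ c → Connected ⁅ c ⁆
  ⁅⁆-connected c P _ a∈ b∈ = subst P (trans (x∈⁅y⁆⇒x≡y c a∈) (sym (x∈⁅y⁆⇒x≡y c b∈)))

  -- Every vertex is routed through `t`: `s` by the edge `s ~ t`, the others inside `C`.
  ⁅⁆∪-connected : ∀ {C s t} → Connected C → t ∈ C → s ~ t → Connected (⁅ s ⁆ ∪ C)
  ⁅⁆∪-connected {C} {s} {t} connected t∈C s~t P spread a∈ b∈ Pa = fromT b∈ (toT a∈ Pa)
    where
    C⊆ : C ⊆ ⁅ s ⁆ ∪ C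
    C⊆ = q⊆p∪q ⁅ s ⁆ C
    s∈ : s ∈ ⁅ s ⁆ ∪ C
    s∈ = x∈⁅x⁆∪p s C
    inC : ∀ {a b} → a ∈ C → b ∈ C → P a → P b
    inC = connected P λ u∈ w∈ → spread (C⊆ u∈) (C⊆ w∈)
    toT : ∀ {a} → a ∈ ⁅ s ⁆ ∪ C → P a → P t
    toT a∈ Pa with x∈p∪q⁻ ⁅ s ⁆ C a∈
    ... | inj₁ a∈s = spread s∈ (C⊆ t∈C) s~t (subst P (x∈⁅y⁆⇒x≡y s a∈s) Pa)
    ... | inj₂ a∈C = inC a∈C t∈C Pa
    fromT : ∀ {b} → b ∈ ⁅ s ⁆ ∪ C → P t → P b
    fromT b∈ Pt with x∈p∪q⁻ ⁅ s ⁆ C b∈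
    ... | inj₁ b∈s = subst P (sym (x∈⁅y⁆⇒x≡y s b∈s)) (spread (C⊆ t∈C) s∈ (adj-sym G s~t) Pt)
    ... | inj₂ b∈C = inC t∈C b∈C Pt

  -- Bounded cliques and splittings.

  CliquesBelow : ℕ → Pred (Fin n) 0ℓ → Set
  CliquesBelow k X = ∀ {K} → (∀ {u} → u ∈ K → X u) → IsClique G K → ∣ K ∣ < k

  -- `Side` is a predicate, so that neighbourhoods and case combinations serve directly; it becomes
  -- a subset only at the end.
  record Split (k : ℕ) (H : Subset n) : Set₁ where
    field
      {Side}  : Pred (Fin n) 0ℓ
      side?   : Decidable Side
      inside  : CliquesBelow k (λ u → u ∈ H × Side u)
      outside : CliquesBelow k (λ u → u ∈ H × ¬ Side u)

  -- Adding `x` to `K` gives a strictly larger clique in `X`, and that has at most `k` vertices.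
  dominated : ∀ {k X K x} → CliquesBelow (suc k) X → X x → (∀ {u} → u ∈ K → X u) →
              IsClique G K → (∀ {u} → u ∈ K → x ~ u) → ∣ K ∣ < k
  dominated {X = X} {K} {x} below Xx K⊆X clique x~K =
    <-≤-trans (p⊂q⇒∣p∣<∣q∣ (p⊂⁅x⁆∪p λ x∈K → adj-irrefl G refl (x~K x∈K))) (s≤s⁻¹ (below K′⊆X clique′))
    where
    K′⊆X : ∀ {u} → u ∈ ⁅ x ⁆ ∪ K → X u
    K′⊆X u∈ with x∈p∪q⁻ ⁅ x ⁆ K u∈
    ... | inj₁ u∈x = subst X (sym (x∈⁅y⁆⇒x≡y x u∈x)) Xx
    ... | inj₂ u∈K = K⊆X u∈K
    clique′ : IsClique G (⁅ x ⁆ ∪ K)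
    clique′ u v u∈ v∈ u≢v with x∈p∪q⁻ ⁅ x ⁆ K u∈ | x∈p∪q⁻ ⁅ x ⁆ K v∈
    ... | inj₂ u∈K | inj₂ v∈K = clique u v u∈K v∈K u≢v
    ... | inj₁ u∈x | inj₂ v∈K = subst (_~ v) (sym (x∈⁅y⁆⇒x≡y x u∈x)) (x~K v∈K)
    ... | inj₂ u∈K | inj₁ v∈x = subst (u ~_) (sym (x∈⁅y⁆⇒x≡y x v∈x)) (adj-sym G (x~K u∈K))
    ... | inj₁ u∈x | inj₁ v∈x =
      contradiction (trans (x∈⁅y⁆⇒x≡y x u∈x) (sym (x∈⁅y⁆⇒x≡y x v∈x))) u≢v

  -- The two forbidden induced subgraphs.

  module _ (P₅-free : P₅ -Free G) (C₅-free : C₅ -Free G) where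

    -- The last non-edge is left in the conclusion, a double negation from which `decidable-stable`
    -- extracts the edge `c ~ e`.
    ¬P₅ : ∀ a b c d e → a ~ b → b ~ c → c ~ d → d ~ e →
          a ≁ c → a ≁ d → a ≁ e → b ≁ d → b ≁ e → ¬ (c ≁ e)
    ¬P₅ a b c d e ab bc cd de ac ad ae bd be ce =
      embedding⇒¬free G (lookup (a ∷ b ∷ c ∷ d ∷ e ∷ [])) (from-yes (twinFree? P₅)) edge P₅-free
      where
      edge : ∀ u v → u <ᶠ v → Reflects _ (does (adj? P₅ u v))
      edge 0F 1F _ = ofʸ ab
      edge 0F 2F _ = ofⁿ ac
      edge 0F 3F _ = ofⁿ ad
      edge 0F 4F _ = ofⁿ ae
      edge 1F 2F _ = ofʸ bc
      edge 1F 3F _ = ofⁿ bd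
      edge 1F 4F _ = ofⁿ be
      edge 2F 3F _ = ofʸ cd
      edge 2F 4F _ = ofⁿ ce
      edge 3F 4F _ = ofʸ de
      edge (suc _) 1F (s≤s ())
      edge (suc (suc _)) 2F (s≤s (s≤s ()))
      edge (suc (suc (suc _))) 3F (s≤s (s≤s (s≤s ())))
      edge 4F 4F (s≤s (s≤s (s≤s (s≤s ()))))

    ¬C₅ : ∀ a b c d e → a ~ b → b ~ c → c ~ d → d ~ e → a ~ e →
          a ≁ c → a ≁ d → b ≁ d → b ≁ e → ¬ (c ≁ e)
    ¬C₅ a b c d e ab bc cd de ae ac ad bd be ce =
      embedding⇒¬free G (lookup (a ∷ b ∷ c ∷ d ∷ e ∷ [])) (from-yes (twinFree? C₅)) edge C₅-free
      where
      edge : ∀ u v → u <ᶠ v → Reflects _ (does (adj? C₅ u v))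
      edge 0F 1F _ = ofʸ ab
      edge 0F 2F _ = ofⁿ ac
      edge 0F 3F _ = ofⁿ ad
      edge 0F 4F _ = ofʸ ae
      edge 1F 2F _ = ofʸ bc
      edge 1F 3F _ = ofⁿ bd
      edge 1F 4F _ = ofⁿ be
      edge 2F 3F _ = ofʸ cd
      edge 2F 4F _ = ofⁿ ce
      edge 3F 4F _ = ofʸ de
      edge (suc _) 1F (s≤s ())
      edge (suc (suc _)) 2F (s≤s (s≤s ()))
      edge (suc (suc (suc _))) 3F (s≤s (s≤s (s≤s ())))
      edge 4F 4F (s≤s (s≤s (s≤s (s≤s ()))))

    -- Saturated connected sets.

    module _ (H : Subset n) where

      -- The sets called S and W in the idea of the proof.
      Attached Far : Subset n → Pred (Fin n) 0ℓ
      Attached C s = s ∈ H × s ∉ C × ∃[ t ] t ∈ C × s ~ t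
      Far      C w = w ∈ H × w ∉ C × (∀ t → t ∈ C → w ≁ t)

      attached? : ∀ C → Decidable (Attached C)
      attached? C s = (s ∈? H) ×-dec ¬? (s ∈? C) ×-dec any? λ t → (t ∈? C) ×-dec adj? G s t

      far? : ∀ C → Decidable (Far C)
      far? C w = (w ∈? H) ×-dec ¬? (w ∈? C) ×-dec all? λ t → (t ∈? C) →-dec ¬? (adj? G w t)

      trichotomy : ∀ C {u} → u ∈ H → u ∈ C ⊎ Attached C u ⊎ Far C u
      trichotomy C {u} u∈H with u ∈? C | attached? C u
      ... | yes u∈C | _     = inj₁ u∈C
      ... | no  _   | yes a = inj₂ (inj₁ a)
      ... | no  u∉C | no ¬a =
        inj₂ (inj₂ (u∈H , u∉C , λ t t∈C u~t → ¬a (u∈H , u∉C , t , t∈C , u~t)))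

      record Separated (C : Subset n) : Set₁ where
        field
          C⊆H       : C ⊆ H
          connected : Connected C
          root      : Nonempty C
          far       : ∃[ v ] Far C v

      -- This is the property that maximality of `C` supplies.
      Saturated : Subset n → Set
      Saturated C = ∀ {s w} → Attached C s → Far C w → s ~ w

      -- `s` joins `C` through its neighbour `t`, and `w` stays far because `s ≁ w`.
      extend : ∀ {C s w} → Separated C → Attached C s → Far C w → s ≁ w → Separated (⁅ s ⁆ ∪ C)
      extend {C} {s} {w} sep (s∈H , _ , t , t∈C , s~t) (w∈H , w∉C , w≁C) s≁w = record
        { C⊆H       = ∪-lub (⁅x⁆⊆ s∈H) C⊆H
        ; connected = ⁅⁆∪-connected connected t∈C s~t
        ; root      = s , x∈⁅x⁆∪p s C
        ; far       = w , w∈H , w∉ , w≁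
        }
        where
        open Separated sep
        w∉ : w ∉ ⁅ s ⁆ ∪ C
        w∉ w∈ with x∈p∪q⁻ ⁅ s ⁆ C w∈
        ... | inj₁ w∈s = w≁C t t∈C (subst (_~ t) (sym (x∈⁅y⁆⇒x≡y s w∈s)) s~t)
        ... | inj₂ w∈C = w∉C w∈C
        w≁ : ∀ u → u ∈ ⁅ s ⁆ ∪ C → w ≁ u
        w≁ u u∈ w~u with x∈p∪q⁻ ⁅ s ⁆ C u∈
        ... | inj₁ u∈s = s≁w (adj-sym G (subst (w ~_) (x∈⁅y⁆⇒x≡y s u∈s) w~u))
        ... | inj₂ u∈C = w≁C u u∈C w~u

      -- While some attached `s` and far `w` are nonadjacent, `s` is absorbed; `C` grows strictly,
      -- so this stops.
      saturate : ∀ {C} → Acc _⊃_ C → Separated C → ∃[ C′ ] Separated C′ × Saturated C′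
      saturate {C} (acc rec) sep
        with any? (λ s → any? λ w → attached? C s ×-dec far? C w ×-dec ¬? (adj? G s w))
      ... | yes (s , w , att , far , s≁w) =
        saturate (rec (p⊂⁅x⁆∪p (proj₁ (proj₂ att)))) (extend sep att far s≁w)
      ... | no none = C , sep , λ {s} {w} att far →
        decidable-stable (adj? G s w) λ s≁w → none (s , w , att , far , s≁w)

      -- Splitting along the neighbourhood of an attached vertex.

      module _ {C} (sep : Separated C) (sat : Saturated C) where
        open Separated sep

        private
          v : Fin n
          v = proj₁ far
          v-far : Far C v
          v-far = proj₂ far
          v≁C : ∀ {c} → c ∈ C → v ≁ c
          v≁C = proj₂ (proj₂ v-far) _
          S~v : ∀ {s} → Attached C s → s ~ v
          S~v att = sat att v-far

        -- Suppose `a` and `b` are private neighbours of `x` and `y`. If `a ~ b`, then `v x a b y`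
        -- is an induced C₅; otherwise `a x v y b` is an induced P₅.
        comparable : ∀ {x y a b} → Attached C x → Attached C y → x ≁ y → x ~ a → y ~ b →
                     a ∈ C → b ∈ C → x ≁ b → ¬ (y ≁ a)
        comparable {x} {y} {a} {b} x∈S y∈S x≁y x~a y~b a∈C b∈C x≁b y≁a with adj? G a b
        ... | yes a~b = ¬C₅ v x a b y (adj-sym G (S~v x∈S)) x~a a~b (adj-sym G y~b) (adj-sym G (S~v y∈S))
                          (v≁C a∈C) (v≁C b∈C) x≁b x≁y (y≁a ∘ adj-sym G)
        ... | no  a≁b = ¬P₅ a x v y b (adj-sym G x~a) (S~v x∈S) (adj-sym G (S~v y∈S)) y~b
                          (v≁C a∈C ∘ adj-sym G) (y≁a ∘ adj-sym G) a≁b x≁y x≁b (v≁C b∈C)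

        module _ {x} (x∈S : Attached C x) where

          spreads : ∀ {c d e} → x ~ c → c ∈ C → c ~ d → d ∈ C → x ≁ d → d ~ e → e ∈ C → x ≁ e → c ~ e
          spreads {c} {d} {e} x~c c∈C c~d d∈C x≁d d~e e∈C x≁e = decidable-stable (adj? G c e)
            (¬P₅ v x c d e (adj-sym G (S~v x∈S)) x~c c~d d~e (v≁C c∈C) (v≁C d∈C) (v≁C e∈C) x≁d x≁e)

          -- The invariant carried through `C` by connectedness. At a non-neighbour of `x` it yields
          -- the vertex `c` that will dominate a clique.
          Near : Pred (Fin n) 0ℓ
          Near u = x ~ u ⊎ (∃[ c ] c ∈ C × x ~ c × c ~ u)

          -- A non-neighbour `w` of `x` takes `u` itself as witness if `x ~ u`; otherwise it
          -- inherits the witness of `u` by `spreads`.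
          near-spreads : ∀ {u w} → u ∈ C → w ∈ C → u ~ w → Near u → Near w
          near-spreads {u} {w} u∈C w∈C u~w near with adj? G x w | adj? G x u | near
          ... | yes x~w | _       | _         = inj₁ x~w
          ... | no  _   | yes x~u | _         = inj₂ (u , u∈C , x~u , u~w)
          ... | no  _   | no x≁u  | inj₁ x~u  = contradiction x~u x≁u
          ... | no x≁w  | no x≁u  | inj₂ (c , c∈C , x~c , c~u) =
            inj₂ (c , c∈C , x~c , spreads x~c c∈C c~u u∈C x≁u u~w w∈C x≁w)

          near : ∀ {u} → u ∈ C → Near u
          near u∈C with proj₂ (proj₂ x∈S)
          ... | t , t∈C , x~t = connected Near near-spreads t∈C u∈C (inj₁ x~t)

          -- The witness `c` for one vertex `d` of `K` serves the whole clique, whose other vertices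
          -- are neighbours of `d`.
          nonneighbours-dominated : ∀ {K} → Nonempty K → (∀ {u} → u ∈ K → u ∈ C × x ≁ u) →
            IsClique G K → ∃[ c ] c ∈ C × (∀ {u} → u ∈ K → c ~ u)
          nonneighbours-dominated {K} (d , d∈K) K⊆ clique with near (proj₁ (K⊆ d∈K))
          ... | inj₁ x~d = contradiction x~d (proj₂ (K⊆ d∈K))
          ... | inj₂ (c , c∈C , x~c , c~d) = c , c∈C , c~K
            where
            c~K : ∀ {u} → u ∈ K → c ~ u
            c~K {u} u∈K with d ≟ᶠ u
            ... | yes refl = c~d
            ... | no  d≢u  = spreads x~c c∈C c~d (proj₁ (K⊆ d∈K)) (proj₂ (K⊆ d∈K))
                               (clique d u d∈K u∈K d≢u) (proj₁ (K⊆ u∈K)) (proj₂ (K⊆ u∈K))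

        trace : Fin n → Subset n
        trace y = comprehension λ u → (u ∈? C) ×-dec adj? G y u

        ∈-trace : ∀ {y u} → u ∈ trace y ⇔ (u ∈ C × y ~ u)
        ∈-trace {y} = ∈-comprehension λ u → (u ∈? C) ×-dec adj? G y u

        largest-trace : ∃[ s ] Attached C s →
          ∃[ x ] Attached C x × (∀ {y} → Attached C y → ∣ trace y ∣ ≤ ∣ trace x ∣)
        largest-trace (s , s∈S) with greatest-satisfies Q? (s , s∈S , z≤n) n
          where
          -- Asking for `k ≤` rather than equality makes 0 a valid fallback value, witnessed by `s`.
          Q? : Decidable (λ k → ∃[ x ] Attached C x × k ≤ ∣ trace x ∣)
          Q? k = any? λ x → attached? C x ×-dec (k ≤? ∣ trace x ∣)
        ... | x , x∈S , max≤ = x , x∈S , λ {y} y∈S →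
          ≤-trans (greatest-upper _ n (∣p∣≤n (trace y)) (y , y∈S , ≤-refl)) max≤

        split-by-neighbourhood : ∀ {k} → CliquesBelow (suc k) (_∈ H) → 0 < k →
          ∃[ s ] Attached C s → Split k H
        split-by-neighbourhood {k} below 0<k S≢∅ with largest-trace S≢∅
        ... | x , x∈S , largest = record
          { side?   = adj? G x
          ; inside  = λ K⊆ clique →
              dominated below (proj₁ x∈S) (proj₁ ∘ K⊆) clique (proj₂ ∘ K⊆)
          ; outside = outside
          }
          where
          -- Otherwise `b` is private to `y`, so `comparable` makes the trace of `x` a proper subset
          -- of that of `y`, against the choice of `x`.
          trace⊆ : ∀ {y} → Attached C y → x ≁ y → ∀ {b} → b ∈ C → y ~ b → x ~ b
          trace⊆ {y} y∈S x≁y {b} b∈C y~b = decidable-stable (adj? G x b) λ x≁b →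
            <-irrefl refl (<-≤-trans
              (p⊂q⇒∣p∣<∣q∣
                ( (λ {a} a∈ → let a∈C , x~a = to ∈-trace a∈ in
                    from ∈-trace (a∈C , decidable-stable (adj? G y a)
                      (comparable x∈S y∈S x≁y x~a y~b a∈C b∈C x≁b)))
                , b , from ∈-trace (b∈C , y~b) , x≁b ∘ proj₂ ∘ to ∈-trace))
              (largest y∈S))

          outside : CliquesBelow k (λ u → u ∈ H × x ≁ u)
          outside {K} K⊆ clique with any? (λ y → (y ∈? K) ×-dec attached? C y) | nonempty? K
          ... | yes (y , y∈K , y∈S) | _ =
            dominated below (proj₁ v-far) (proj₁ ∘ K⊆) clique (λ u∈K → adj-sym G (S~v (K⊆S u∈K)))
            where
            K⊆S : ∀ {u} → u ∈ K → Attached C u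
            K⊆S {u} u∈K with trichotomy C (proj₁ (K⊆ u∈K))
            ... | inj₂ (inj₁ u∈S) = u∈S
            ... | inj₂ (inj₂ u∈W) = contradiction (sat x∈S u∈W) (proj₂ (K⊆ u∈K))
            -- A vertex of `C` in `K` is adjacent to `y`, hence to `x` by `trace⊆`; but `K` avoids
            -- the neighbours of `x`.
            ... | inj₁ u∈C = contradiction
              (trace⊆ y∈S (proj₂ (K⊆ y∈K)) u∈C
                (clique y u y∈K u∈K λ { refl → proj₁ (proj₂ y∈S) u∈C }))
              (proj₂ (K⊆ u∈K))
          ... | no K∩S≡∅ | yes K≢∅ =
            let c , c∈C , c~K = nonneighbours-dominated x∈S K≢∅ K⊆C clique
            in dominated below (C⊆H c∈C) (proj₁ ∘ K⊆) clique c~K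
            where
            K⊆C : ∀ {u} → u ∈ K → u ∈ C × x ≁ u
            K⊆C {u} u∈K with trichotomy C (proj₁ (K⊆ u∈K))
            ... | inj₁ u∈C        = u∈C , proj₂ (K⊆ u∈K)
            ... | inj₂ (inj₁ u∈S) = contradiction (u , u∈K , u∈S) K∩S≡∅
            ... | inj₂ (inj₂ u∈W) = contradiction (sat x∈S u∈W) (proj₂ (K⊆ u∈K))
          ... | no _ | no K≡∅ = subst (λ K → ∣ K ∣ < k) (sym (Empty-unique K≡∅))
            (subst (_< k) (sym (∣⊥∣≡0 n)) 0<k)

      -- Gluing splittings, and induction on `H`.

      split-union : ∀ {k C} → (∀ {u w} → u ∈ C → w ∈ H → w ∉ C → u ≁ w) →
        Split k C → Split k (H ∩ ∁ C) → Split k H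
      split-union {k} {C} anticomplete split₁ split₂ = record
        { side?   = side?
        ; inside  = λ {K} K⊆ clique → case K⊆ clique
            (λ all∈C → A.inside (λ u∈K → all∈C u∈K , pick₁ (all∈C u∈K) (proj₂ (K⊆ u∈K))) clique)
            (λ all∉C → B.inside (λ u∈K → rest (K⊆ u∈K) (all∉C u∈K) , pick₂ (all∉C u∈K) (proj₂ (K⊆ u∈K))) clique)
        ; outside = λ {K} K⊆ clique → case K⊆ clique
            (λ all∈C → A.outside (λ u∈K → all∈C u∈K , λ s → proj₂ (K⊆ u∈K) (inj₁ (all∈C u∈K , s))) clique)
            (λ all∉C → B.outside (λ u∈K → rest (K⊆ u∈K) (all∉C u∈K) , λ s → proj₂ (K⊆ u∈K) (inj₂ (all∉C u∈K , s))) clique)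
        }
        where
        module A = Split split₁
        module B = Split split₂
        Side : Pred (Fin n) 0ℓ
        Side u = (u ∈ C × A.Side u) ⊎ (u ∉ C × B.Side u)
        side? : Decidable Side
        side? u = ((u ∈? C) ×-dec A.side? u) ⊎-dec (¬? (u ∈? C) ×-dec B.side? u)
        pick₁ : ∀ {u} → u ∈ C → Side u → A.Side u
        pick₁ _   (inj₁ (_ , s))   = s
        pick₁ u∈C (inj₂ (u∉C , _)) = contradiction u∈C u∉C
        pick₂ : ∀ {u} → u ∉ C → Side u → B.Side u
        pick₂ u∉C (inj₁ (u∈C , _)) = contradiction u∈C u∉C
        pick₂ _   (inj₂ (_ , s))   = s
        rest : ∀ {u} {X : Set} → u ∈ H × X → u ∉ C → u ∈ H ∩ ∁ C
        rest (u∈H , _) u∉C = x∈p∩q⁺ (u∈H , x∉p⇒x∈∁p u∉C)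
        -- No edge leaves `C` within `H`, so a single vertex in `C` puts the whole clique there.
        -- Hence the two splittings combine freely.
        case : ∀ {K} {X : Pred (Fin n) 0ℓ} {R : Set} → (∀ {u} → u ∈ K → u ∈ H × X u) → IsClique G K →
               ((∀ {u} → u ∈ K → u ∈ C) → R) → ((∀ {u} → u ∈ K → u ∉ C) → R) → R
        case {K} K⊆ clique f g with any? (λ u → (u ∈? K) ×-dec (u ∈? C))
        ... | no none = g λ {u} u∈K u∈C → none (u , u∈K , u∈C)
        ... | yes (c , c∈K , c∈C) = f λ {u} u∈K → decidable-stable (u ∈? C) λ u∉C →
          anticomplete c∈C (proj₁ (K⊆ u∈K)) u∉C (clique c u c∈K u∈K λ { refl → u∉C c∈C })

    -- Stated for any `k ≥ 2` bounding the clique number of `H`, because the parts met in the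
    -- induction may have smaller clique number or no edge at all.
    split : ∀ {k} → 1 < k → ∀ {H} → Acc _⊂_ H → CliquesBelow (suc k) (_∈ H) → Split k H
    split {k} 1<k {H} (acc rec) below with nonempty? H
    ... | no H≡∅ = record
      { Side = _∈ H ; side? = _∈? H ; inside = empty ; outside = empty }
      where
      empty : ∀ {X : Pred (Fin n) 0ℓ} → CliquesBelow k (λ u → u ∈ H × X u)
      empty {K = K} K⊆ _ = subst (λ K → ∣ K ∣ < k) (sym (Empty-unique λ (u , u∈K) → H≡∅ (u , proj₁ (K⊆ u∈K))))
        (subst (_< k) (sym (∣⊥∣≡0 n)) (<⇒≤ 1<k))
    ... | yes (c , c∈H) with any? (far? H ⁅ c ⁆)
    ...   | no none = record
      { side?   = adj? G c
      ; inside  = λ K⊆ clique → dominated below c∈H (proj₁ ∘ K⊆) clique (proj₂ ∘ K⊆)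
      -- No vertex is far from `c`, so outside its neighbourhood there is at most `c` itself, and
      -- `1 < k` covers a single vertex.
      ; outside = λ {K} K⊆ _ → ≤-trans (s≤s (≤-trans (p⊆q⇒∣p∣≤∣q∣ (K⊆c K⊆)) (≤-reflexive (∣⁅x⁆∣≡1 c)))) 1<k
      }
      where
      K⊆c : ∀ {K} → (∀ {u} → u ∈ K → u ∈ H × c ≁ u) → K ⊆ ⁅ c ⁆
      K⊆c K⊆ {u} u∈K with K⊆ u∈K
      ... | u∈H , c≁u = decidable-stable (u ∈? ⁅ c ⁆) λ u∉ → none
        (u , u∈H , u∉ , λ t t∈ u~t → c≁u (adj-sym G (subst (u ~_) (x∈⁅y⁆⇒x≡y c t∈) u~t)))
    ...   | yes c-far with saturate H (⊃-wellFounded ⁅ c ⁆) record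
      { C⊆H = ⁅x⁆⊆ c∈H ; connected = ⁅⁆-connected c ; root = c , x∈⁅x⁆ c ; far = c-far }
    ...     | C , sep , sat with any? (attached? H C)
    ...       | yes S≢∅ = split-by-neighbourhood H sep sat below (<⇒≤ 1<k) S≢∅
    ...       | no  S≡∅ = split-union H
      (λ {u} {w} u∈C w∈H w∉C u~w → S≡∅ (w , w∈H , w∉C , u , u∈C , adj-sym G u~w))
      -- Both calls are on proper subsets: `C` misses the far vertex `v`, and the rest of `H` misses
      -- the root `c′`.
      (split 1<k (rec (C⊆H , v , v∈H , v∉C)) (λ K⊆ → below (C⊆H ∘ K⊆)))
      (split 1<k
        (rec (p∩q⊆p H (∁ C) , c′ , C⊆H c′∈C , λ c′∈ → x∈∁p⇒x∉p (p∩q⊆q H (∁ C) c′∈) c′∈C))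
        (λ K⊆ → below (p∩q⊆p H (∁ C) ∘ K⊆)))
      where
      open Separated sep
      v   = proj₁ far
      v∈H = proj₁ (proj₂ far)
      v∉C = proj₁ (proj₂ (proj₂ far))
      c′   = proj₁ root
      c′∈C = proj₂ root

-- From splittings to partitions and clique numbers.

∩-∁-partition : ∀ {n} (H P : Subset n) → IsPartition H (H ∩ P) (H ∩ ∁ P)
∩-∁-partition H P =
    trans (sym (∩-distribˡ-∪ H P (∁ P))) (trans (cong (H ∩_) (p∪∁p≡⊤ P)) (∩-identityʳ H))
  , Empty-unique λ (u , u∈) →
      let u∈HP , u∈H∁P = x∈p∩q⁻ (H ∩ P) (H ∩ ∁ P) u∈
      in x∈∁p⇒x∉p (p∩q⊆q H (∁ P) u∈H∁P) (p∩q⊆q H P u∈HP)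

theorem2p1 : (n : ℕ) (G : Graph n) → P₅ -Free G → C₅ -Free G → TwoDivisible G
theorem2p1 n G P₅-free C₅-free H (u , v , u∈H , v∈H , u~v) =
  H ∩ P , H ∩ ∁ P , ∩-∁-partition H P ,
  ω< inside (λ x∈ → let x∈H , x∈P = x∈p∩q⁻ H P x∈ in x∈H , to ∈P x∈P) ,
  ω< outside (λ x∈ → let x∈H , x∉P = x∈p∩q⁻ H (∁ P) x∈ in x∈H , x∈∁p⇒x∉p x∉P ∘ from ∈P)
  where
  below : CliquesBelow G (suc (ω G H)) (_∈ H)
  below {K} K⊆H clique = s≤s (ω-maximal G H K K⊆H clique)

  -- The one-vertex clique at `v` is dominated by `u`, so it is not maximum.
  1<ω : 1 < ω G H
  1<ω = subst (_< ω G H) (∣⁅x⁆∣≡1 v) (dominated G below u∈H (⁅x⁆⊆ v∈H)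
    (λ a b a∈ b∈ a≢b → contradiction (trans (x∈⁅y⁆⇒x≡y v a∈) (sym (x∈⁅y⁆⇒x≡y v b∈))) a≢b)
    (λ a∈ → subst (Adj G u) (sym (x∈⁅y⁆⇒x≡y v a∈)) u~v))

  open Split (split G P₅-free C₅-free 1<ω (⊂-wellFounded H) below)

  P : Subset n
  P = comprehension side?

  ∈P : ∀ {x} → x ∈ P ⇔ Side x
  ∈P = ∈-comprehension side?

  ω< : ∀ {k X A} → CliquesBelow G k X → (∀ {x} → x ∈ A → X x) → ω G A < k
  ω< {k} {A = A} cliques<k A⊆X with ω-attained G A
  ... | K , K⊆A , clique , ∣K∣≡ω = subst (_< k) ∣K∣≡ω (cliques<k (A⊆X ∘ K⊆A) clique)
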